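{- For all $n \geq 1$, \[ A_n(u,v) = \sum_{e \in \mathbb{I}_n} u^{\mathrm{asc}(e)} v^{\mathrm{row}(e)}, \] where $A_n(u,v) = \sum_{\pi\in\mathbb{S}_n} u^{\mathrm{des}(\pi)}v^{\mathrm{des}(\pi^{ -1})}$ is the double Eulerian polynomial.
   Context: Permutations $w \in \mathbb{S}_n$ are identified with words $w_1\dots w_n$. The descent set of $w$ is $\mathrm{DES}(w) = \{i : w_i > w_{i+1}\}$ and $\mathrm{des}(w) = \#\mathrm{DES}(w)$ is its number of descents. An inversion table of length $n$ is a sequence $e = e_1\dots e_n$ of positive integers with $1 \leq e_i \leq i$ for all $i$ (so $e_1 = 1$); $\mathbb{I}_n$ denotes the set of inversion tables of length $n$. For $e \in \mathbb{I}_n$ define $\mathrm{ASC}(e) = \{i : e_i < e_{i+1}\}$ (strict inequality) and $\mathrm{ROW}(e) = \{e_i : 1 \leq i \leq n\} \setminus \{1\}$, and let $\mathrm{asc}(e) = \#\mathrm{ASC}(e)$ and $\mathrm{row}(e) = \#\mathrm{ROW}(e)$. -}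

module Defs where

open import Data.Nat using (ℕ; zero; suc; _+_; _<ᵇ_; _≡ᵇ_; _≟_)
open import Data.Bool using (Bool; true; false; if_then_else_; _∧_; not)
open import Data.List using (List; []; _∷_; _++_; [_]; map; concatMap; upTo; length; filterᵇ; deduplicate)
open import Data.List.Relation.Unary.Unique.DecPropositional _≟_ using (unique?)
open import Relation.Nullary.Decidable using (does)

words : ℕ → ℕ → List (List ℕ)
words zero    m = [] ∷ []
words (suc k) m = concatMap (λ x → map (x ∷_) (words k m)) (upTo m)

-- The symmetric group S_n, as the list of all permutation words w₁…wₙ
-- of {0,…,n-1} (letters shifted by one; irrelevant for descents).
perms : ℕ → List (List ℕ)
perms n = filterᵇ (λ w → does (unique? w)) (words n n)

des : List ℕ → ℕ
des []           = 0
des (x ∷ [])     = 0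
des (x ∷ y ∷ r)  = (if y <ᵇ x then 1 else 0) + des (y ∷ r)

pos : ℕ → List ℕ → ℕ
pos v []      = 0
pos v (x ∷ w) = if v ≡ᵇ x then 0 else suc (pos v w)

inverse : ℕ → List ℕ → List ℕ
inverse n w = map (λ v → pos v w) (upTo n)

invTables : ℕ → List (List ℕ)
invTables zero    = [] ∷ []
invTables (suc n) = concatMap (λ e → map (λ k → e ++ [ suc k ]) (upTo (suc n))) (invTables n)

asc : List ℕ → ℕ
asc []          = 0
asc (x ∷ [])    = 0
asc (x ∷ y ∷ r) = (if x <ᵇ y then 1 else 0) + asc (y ∷ r)

row : List ℕ → ℕ
row e = length (deduplicate _≟_ (filterᵇ (λ x → not (x ≡ᵇ 1)) e))

-- coefficient of u^a v^b in A_n(u,v) = Σ_{π ∈ S_n} u^{des π} v^{des π⁻¹}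
coeffA : ℕ → ℕ → ℕ → ℕ
coeffA n a b = length (filterᵇ (λ w → (des w ≡ᵇ a) ∧ (des (inverse n w) ≡ᵇ b)) (perms n))

-- coefficient of u^a v^b in Σ_{e ∈ I_n} u^{asc e} v^{row e}
coeffI : ℕ → ℕ → ℕ → ℕ
coeffI n a b = length (filterᵇ (λ e → (asc e ≡ᵇ a) ∧ (row e ≡ᵇ b)) (invTables n))

{-# OPTIONS --safe #-}
module Submission where

-- Both sides are generated letter by letter: an inversion table of length n is extended
-- by any of its n + 1 admissible values, a permutation word of length n by any last letter
-- p ≤ n (the old letters ≥ p being raised by one), which inserts a new maximum into gap p
-- of the inverse.  In both cases the state is a row of n + 1 marked or unmarked cells, cut
-- at the current cell into a part B and a part A: marked cells are the values used so far,
-- respectively the gaps of the inverse that are descents or the right end.  A step picks a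
-- cell and marks it; picking in A scores one ascent (descent).  The new unmarked cell
-- appears at the far end of A for tables and next to the picked cell for permutations.
--
-- The number of continuations with given statistics is invariant under rearranging the
-- cells of B and of A, so the two processes agree.  This invariance survives a step into B
-- once it is coupled with the exchange identity in Exchangeable; it is clear for a step
-- into A ∪ B, which depends on the whole row only, and hence holds for a step into A by
-- subtraction.

open import Defs
open import Data.Nat using (ℕ; zero; suc; pred; _+_; _∸_; _≤_; _<_; _<ᵇ_; _≡ᵇ_; z≤n; s≤s; s≤s⁻¹; _≟_; _<?_)
open import Data.Nat.Properties
open import Algebra.Properties.CommutativeSemigroup +-commutativeSemigroup
  using (interchange; x∙yz≈y∙xz; x∙yz≈yx∙z; xy∙z≈xz∙y)
open import Data.Nat.ListAction using (sum)
open import Data.Nat.ListAction.Properties using (sum-++; sum-↭)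
open import Data.Bool using (Bool; true; false; if_then_else_; _∧_; _∨_; T; not)
open import Data.List
  using (List; []; _∷_; _++_; [_]; _∷ʳ_; _ʳ++_; map; length; filterᵇ; upTo; downFrom; applyUpTo; applyDownFrom;
         cartesianProductWith; concatMap; deduplicate; initLast; _∷ʳ′_)
open import Data.List.Properties
  using (length-++; length-map; map-injective; ∷ʳ-injective; ++-identityʳ; map-++; map-∘; map-id-local;
         map-cong-local; map-upTo; applyUpTo-∷ʳ; ʳ++-defn)
open import Data.List.Membership.Propositional using (_∈_; _∉_)
open import Data.List.Membership.Propositional.Properties
open import Data.List.Membership.Propositional.Properties.WithK using (unique∧set⇒bag)
open import Data.List.Membership.DecPropositional _≟_ using (_∈?_)
open import Data.List.Relation.Unary.Any using (here; there)
open import Data.List.Relation.Unary.All as All using (All; []; _∷_)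
import Data.List.Relation.Unary.All.Properties as All
open import Data.List.Relation.Unary.Unique.Propositional using (Unique; []; _∷_)
import Data.List.Relation.Unary.Unique.Propositional.Properties as Unique
open import Data.List.Relation.Unary.Unique.DecPropositional _≟_ using (unique?)
open import Data.List.Relation.Unary.Unique.DecPropositional.Properties _≟_ using (deduplicate-!)
open import Data.List.Relation.Binary.BagAndSetEquality using (∼bag⇒↭)
open import Data.List.Relation.Binary.Permutation.Propositional
  using (_↭_; prep; swap; ↭-refl; ↭-sym; ↭-trans; ↭-reflexive; ↭⇒↭ₛ)
open import Data.List.Relation.Binary.Permutation.Propositional.Properties
  using (++-comm; ++⁺; ++⁺ʳ; shift; ∷↭∷ʳ; ↭-reverse; ↭-length; map⁺)
open import Data.Product using (∃; _×_; _,_; proj₁; proj₂)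
open import Data.Sum using (inj₁; inj₂)
open import Relation.Nullary using (yes; no; does; contradiction; T?; Dec)
open import Relation.Nullary.Decidable using (dec-true; dec-false; does-⇔)
open import Relation.Binary.Definitions using (tri<; tri≈; tri>)
open import Relation.Binary.PropositionalEquality
  using (_≡_; _≢_; refl; sym; trans; cong; cong₂; subst; ≢-sym; setoid; module ≡-Reasoning)
open import Data.List.Relation.Binary.Permutation.Setoid.Properties (setoid ℕ) using (Unique-resp-↭)
open import Function using (_∘_; flip; mk⇔; Injective)

-- Exchangeable statistics of a cut row

-- The first argument is B and the second is A, each read from the cut outwards; true = marked.
Statistic : Set
Statistic = List Bool → List Bool → ℕ

_⊕_ : Statistic → Statistic → Statistic
(Φ ⊕ Ψ) B A = Φ B A + Ψ B A

-- The picked cell is handed to `Ψ` in neither argument, so that `mark` can put it back marked; the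
-- cells between it and the cut have moved across to the other side.
walk : Statistic → Statistic
walk Ψ []      A = 0
walk Ψ (x ∷ B) A = Ψ B A + walk Ψ B (x ∷ A)

walk-cong : ∀ {Ψ Ψ′} → (∀ B A → Ψ B A ≡ Ψ′ B A) → ∀ B A → walk Ψ B A ≡ walk Ψ′ B A
walk-cong eq []      A = refl
walk-cong eq (x ∷ B) A = cong₂ _+_ (eq B A) (walk-cong eq B (x ∷ A))

-- Carrying the cells of `A` over the cut one at a time turns each pick in `A` into a pick in `B`;
-- in the end the cut stands at the far end of `A`.
walk-both : ∀ Ψ B A → walk Ψ B A + walk (flip Ψ) A B ≡ walk Ψ (A ʳ++ B) []
walk-both Ψ B []      = +-identityʳ _
walk-both Ψ B (x ∷ A) = trans (x∙yz≈yx∙z (walk Ψ B (x ∷ A)) (Ψ B A) _) (walk-both Ψ (x ∷ B) A)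

mark : (List Bool → List Bool) → Statistic → Statistic
mark push Φ B A = Φ (true ∷ B) (push A)

-- In both cases the new cut is just behind the picked cell, which becomes the head of B.
low high : (List Bool → List Bool) → Statistic → Statistic
low  push Φ B A = walk (mark push Φ) B A
high push Φ B A = walk (flip (mark push Φ)) A B

pushFront pushBack : List Bool → List Bool
pushFront A = false ∷ A
pushBack  A = A ++ [ false ]

Invariant : Statistic → Set
Invariant Φ = ∀ {B B′ A A′} → B ↭ B′ → A ↭ A′ → Φ B A ≡ Φ B′ A′

Flat : Statistic → Set
Flat Φ = ∀ {B B′ A A′} → B ++ A ↭ B′ ++ A′ → Φ B A ≡ Φ B′ A′

-- Read as a difference, `exchange` says that moving a cell from `A` into a `B` with a marked cell
-- changes `Φ` by an amount independent of whether the moved cell is marked. Sums replace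
-- differences because the values are natural numbers.
record Exchangeable (Φ : Statistic) : Set where
  field
    invariant : Invariant Φ
    exchange  : ∀ x y B A → Φ (true ∷ y ∷ B) A + Φ (true ∷ B) (x ∷ A)
                          ≡ Φ (true ∷ x ∷ B) A + Φ (true ∷ B) (y ∷ A)

open Exchangeable

-- For a flat statistic the side on which `x` or `y` lies is irrelevant, so both sides of `exchange`
-- have the same two summands.
flat⇒exchangeable : ∀ {Φ} → Flat Φ → Exchangeable Φ
flat⇒exchangeable {Φ} flat = record
  { invariant = λ p q → flat (++⁺ p q)
  ; exchange  = λ x y B A → trans (+-comm (Φ (true ∷ y ∷ B) A) _)
      (cong₂ _+_ (flat (prep true (shift x B A))) (flat (prep true (↭-sym (shift y B A)))))
  }

⊕-exchangeable : ∀ {Φ Ψ} → Exchangeable Φ → Exchangeable Ψ → Exchangeable (Φ ⊕ Ψ)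
⊕-exchangeable {Φ} {Ψ} e f = record
  { invariant = λ p q → cong₂ _+_ (invariant e p q) (invariant f p q)
  ; exchange  = λ x y B A → begin
      (Φ (true ∷ y ∷ B) A + Ψ (true ∷ y ∷ B) A) + (Φ (true ∷ B) (x ∷ A) + Ψ (true ∷ B) (x ∷ A))
        ≡⟨ interchange (Φ (true ∷ y ∷ B) A) _ _ _ ⟩
      (Φ (true ∷ y ∷ B) A + Φ (true ∷ B) (x ∷ A)) + (Ψ (true ∷ y ∷ B) A + Ψ (true ∷ B) (x ∷ A))
        ≡⟨ cong₂ _+_ (exchange e x y B A) (exchange f x y B A) ⟩
      (Φ (true ∷ x ∷ B) A + Φ (true ∷ B) (y ∷ A)) + (Ψ (true ∷ x ∷ B) A + Ψ (true ∷ B) (y ∷ A))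
        ≡⟨ interchange (Φ (true ∷ x ∷ B) A) _ _ _ ⟩
      (Φ (true ∷ x ∷ B) A + Ψ (true ∷ x ∷ B) A) + (Φ (true ∷ B) (y ∷ A) + Ψ (true ∷ B) (y ∷ A)) ∎
  }
  where open ≡-Reasoning

-- Both conditions are linear in the statistic, and addition of natural numbers is cancellative.
⊕-cancelˡ-exchangeable : ∀ {Φ Ψ} → Exchangeable Φ → Exchangeable (Φ ⊕ Ψ) → Exchangeable Ψ
⊕-cancelˡ-exchangeable {Φ} {Ψ} e f = record
  { invariant = λ {B} {B′} {A} {A′} p q → +-cancelˡ-≡ (Φ B A) _ _
      (trans (invariant f p q) (cong (_+ Ψ B′ A′) (sym (invariant e p q))))
  ; exchange  = λ x y B A → +-cancelˡ-≡ (Φ (true ∷ y ∷ B) A + Φ (true ∷ B) (x ∷ A)) _ _ (begin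
      (Φ (true ∷ y ∷ B) A + Φ (true ∷ B) (x ∷ A)) + (Ψ (true ∷ y ∷ B) A + Ψ (true ∷ B) (x ∷ A))
        ≡⟨ interchange (Φ (true ∷ y ∷ B) A) _ _ _ ⟩
      (Φ (true ∷ y ∷ B) A + Ψ (true ∷ y ∷ B) A) + (Φ (true ∷ B) (x ∷ A) + Ψ (true ∷ B) (x ∷ A))
        ≡⟨ exchange f x y B A ⟩
      (Φ (true ∷ x ∷ B) A + Ψ (true ∷ x ∷ B) A) + (Φ (true ∷ B) (y ∷ A) + Ψ (true ∷ B) (y ∷ A))
        ≡⟨ interchange (Φ (true ∷ x ∷ B) A) _ _ _ ⟩
      (Φ (true ∷ x ∷ B) A + Φ (true ∷ B) (y ∷ A)) + (Ψ (true ∷ x ∷ B) A + Ψ (true ∷ B) (y ∷ A))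
        ≡⟨ cong (_+ (Ψ (true ∷ x ∷ B) A + Ψ (true ∷ B) (y ∷ A))) (exchange e x y B A) ⟨
      (Φ (true ∷ y ∷ B) A + Φ (true ∷ B) (x ∷ A)) + (Ψ (true ∷ x ∷ B) A + Ψ (true ∷ B) (y ∷ A)) ∎)
  }
  where open ≡-Reasoning

-- Stability of exchangeability under a step

module _ {Φ : Statistic} (e : Exchangeable Φ) where
  private Lo = low pushFront Φ

  low-invariantʳ : ∀ B {A A′} → A ↭ A′ → Lo B A ≡ Lo B A′
  low-invariantʳ []      q = refl
  low-invariantʳ (x ∷ B) q = cong₂ _+_ (invariant e ↭-refl (prep false q)) (low-invariantʳ B (prep x q))

  -- Picks beyond both cells see them in `A`, where their order is irrelevant. Picking `x` or `y`
  -- gives two summands in either order, and their sums agree by `exchange` with the new cell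
  -- included in `A`.
  low-swap : ∀ x y B A → Lo (x ∷ y ∷ B) A ≡ Lo (y ∷ x ∷ B) A
  low-swap x y B A = begin
    Φ (true ∷ y ∷ B) (false ∷ A) + (Φ (true ∷ B) (false ∷ x ∷ A) + Lo B (y ∷ x ∷ A))
      ≡⟨ +-assoc (Φ (true ∷ y ∷ B) (false ∷ A)) _ _ ⟨
    (Φ (true ∷ y ∷ B) (false ∷ A) + Φ (true ∷ B) (false ∷ x ∷ A)) + Lo B (y ∷ x ∷ A)
      ≡⟨ cong₂ _+_ (cong (Φ (true ∷ y ∷ B) (false ∷ A) +_) (invariant e ↭-refl (swap false x ↭-refl)))
                   (low-invariantʳ B (swap y x ↭-refl)) ⟩
    (Φ (true ∷ y ∷ B) (false ∷ A) + Φ (true ∷ B) (x ∷ false ∷ A)) + Lo B (x ∷ y ∷ A)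
      ≡⟨ cong (_+ Lo B (x ∷ y ∷ A)) (exchange e x y B (false ∷ A)) ⟩
    (Φ (true ∷ x ∷ B) (false ∷ A) + Φ (true ∷ B) (y ∷ false ∷ A)) + Lo B (x ∷ y ∷ A)
      ≡⟨ cong (λ z → (Φ (true ∷ x ∷ B) (false ∷ A) + z) + Lo B (x ∷ y ∷ A))
              (invariant e ↭-refl (swap y false ↭-refl)) ⟩
    (Φ (true ∷ x ∷ B) (false ∷ A) + Φ (true ∷ B) (false ∷ y ∷ A)) + Lo B (x ∷ y ∷ A)
      ≡⟨ +-assoc (Φ (true ∷ x ∷ B) (false ∷ A)) _ _ ⟩
    Φ (true ∷ x ∷ B) (false ∷ A) + (Φ (true ∷ B) (false ∷ y ∷ A) + Lo B (x ∷ y ∷ A)) ∎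
    where open ≡-Reasoning

  low-invariant : Invariant Lo
  low-invariant {B} _↭_.refl q = low-invariantʳ B q
  low-invariant (prep x p) q =
    cong₂ _+_ (invariant e (prep true p) (prep false q)) (low-invariant p (prep x q))
  low-invariant {x ∷ y ∷ B} {A = A} (swap x y p) q = trans (low-swap x y B A)
    (cong₂ _+_ (invariant e (prep true (prep x p)) (prep false q))
      (cong₂ _+_ (invariant e (prep true p) (prep false (prep y q)))
                 (low-invariant p (prep x (prep y q)))))
  low-invariant (_↭_.trans p p′) q = trans (low-invariant p ↭-refl) (low-invariant p′ q)

  low-exchangeable : Exchangeable Lo
  low-exchangeable = record
    { invariant = low-invariant
    ; exchange  = λ x y B A → begin
        Lo (true ∷ y ∷ B) A + Lo (true ∷ B) (x ∷ A)
          -- With `y` in front, picking it marks it and erases its state. The sum that results is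
          -- symmetric in `x` and `y`.
          ≡⟨ cong (_+ Lo (true ∷ B) (x ∷ A)) (low-swap true y B A) ⟩
        (Φ (true ∷ true ∷ B) (false ∷ A) + Lo (true ∷ B) (y ∷ A)) + Lo (true ∷ B) (x ∷ A)
          ≡⟨ xy∙z≈xz∙y (Φ (true ∷ true ∷ B) (false ∷ A)) _ _ ⟩
        (Φ (true ∷ true ∷ B) (false ∷ A) + Lo (true ∷ B) (x ∷ A)) + Lo (true ∷ B) (y ∷ A)
          ≡⟨ cong (_+ Lo (true ∷ B) (y ∷ A)) (low-swap true x B A) ⟨
        Lo (true ∷ x ∷ B) A + Lo (true ∷ B) (y ∷ A) ∎
    }
    where open ≡-Reasoning

  -- By `walk-both` the sum is a single `low` with the whole row on the `B` side and nothing in `A`,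
  -- and `low` is invariant under all rearrangements of `B`.
  low⊕high-flat : Flat (low pushFront Φ ⊕ high pushFront Φ)
  low⊕high-flat {B} {B′} {A} {A′} p =
    trans (walk-both (mark pushFront Φ) B A)
      (trans (low-invariant (↭-trans (ʳ++-↭ A B) (↭-trans p (↭-sym (ʳ++-↭ A′ B′)))) ↭-refl)
        (sym (walk-both (mark pushFront Φ) B′ A′)))
    where
    ʳ++-↭ : (xs ys : List Bool) → xs ʳ++ ys ↭ ys ++ xs
    ʳ++-↭ xs ys = ↭-trans (↭-reflexive (ʳ++-defn xs))
      (↭-trans (++⁺ʳ ys (↭-reverse xs)) (++-comm xs ys))

  high-exchangeable : Exchangeable (high pushFront Φ)
  high-exchangeable = ⊕-cancelˡ-exchangeable low-exchangeable 
    (flat⇒exchangeable (λ {B} {B′} {A} {A′} → low⊕high-flat {B} {B′} {A} {A′}))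

-- Here `m` steps remain and `d` is the score so far; `final` is summed over all choices of the
-- remaining cells.
continuations : (List Bool → List Bool) → (ℕ → Statistic) → ℕ → ℕ → Statistic
continuations push final zero    d = final d
continuations push final (suc m) d =
  low push (continuations push final m d) ⊕ high push (continuations push final m (suc d))

module _ {final : ℕ → Statistic} (flat : ∀ d → Flat (final d)) where

  continuations-exchangeable : ∀ m d → Exchangeable (continuations pushFront final m d)
  continuations-exchangeable zero    d = flat⇒exchangeable (flat d)
  continuations-exchangeable (suc m) d =
    ⊕-exchangeable (low-exchangeable (continuations-exchangeable m d))
                   (high-exchangeable (continuations-exchangeable m (suc d)))

  -- The two rules for the new cell differ by a rearrangement of `A`, to which the `pushFront`
  -- process is insensitive; only its exchangeability is required, and the induction transfers the
  -- value.
  continuations-pushBack : ∀ m d B A →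
    continuations pushBack final m d B A ≡ continuations pushFront final m d B A
  continuations-pushBack zero    d B A = refl
  continuations-pushBack (suc m) d B A =
    cong₂ _+_ (walk-cong (mark-pushBack d) B A) (walk-cong (λ A′ B′ → mark-pushBack (suc d) B′ A′) A B)
    where
    mark-pushBack : ∀ d B A → mark pushBack (continuations pushBack final m d) B A
                            ≡ mark pushFront (continuations pushFront final m d) B A
    mark-pushBack d B A = trans (continuations-pushBack m d (true ∷ B) (A ++ [ false ]))
      (invariant (continuations-exchangeable m d) ↭-refl (↭-sym (∷↭∷ʳ false A)))

-- Summing over the cells of a row

bit : Bool → ℕ
bit b = if b then 1 else 0

sum-applyUpTo-cong : ∀ {G H : ℕ → ℕ} n → (∀ {p} → p < n → G p ≡ H p) →
                     sum (applyUpTo G n) ≡ sum (applyUpTo H n)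
sum-applyUpTo-cong zero    eq = refl
sum-applyUpTo-cong (suc n) eq = cong₂ _+_ (eq (s≤s z≤n)) (sum-applyUpTo-cong n (λ p<n → eq (s≤s p<n)))

sum-applyUpTo-∷ʳ : ∀ (G : ℕ → ℕ) n → sum (applyUpTo G (suc n)) ≡ G n + sum (applyUpTo G n)
sum-applyUpTo-∷ʳ G n = begin
  sum (applyUpTo G (suc n))   ≡⟨ cong sum (applyUpTo-∷ʳ G n) ⟨
  sum (applyUpTo G n ∷ʳ G n)  ≡⟨ sum-↭ (∷↭∷ʳ (G n) (applyUpTo G n)) ⟨
  G n + sum (applyUpTo G n)   ∎
  where open ≡-Reasoning

sum-applyUpTo-+ : ∀ (G : ℕ → ℕ) k m →
  sum (applyUpTo G (m + k)) ≡ sum (applyUpTo G k) + sum (applyUpTo (λ i → G (i + k)) m)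
sum-applyUpTo-+ G k zero    = sym (+-identityʳ _)
sum-applyUpTo-+ G k (suc m) = begin
  sum (applyUpTo G (suc (m + k)))
    ≡⟨ sum-applyUpTo-∷ʳ G (m + k) ⟩
  G (m + k) + sum (applyUpTo G (m + k))
    ≡⟨ cong (G (m + k) +_) (sum-applyUpTo-+ G k m) ⟩
  G (m + k) + (sum (applyUpTo G k) + sum (applyUpTo H m))
    ≡⟨ x∙yz≈y∙xz (G (m + k)) (sum (applyUpTo G k)) (sum (applyUpTo H m)) ⟩
  sum (applyUpTo G k) + (H m + sum (applyUpTo H m))
    ≡⟨ cong (sum (applyUpTo G k) +_) (sum-applyUpTo-∷ʳ H m) ⟨
  sum (applyUpTo G k) + sum (applyUpTo H (suc m)) ∎
  where
  open ≡-Reasoning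
  H = λ i → G (i + k)

segment : (ℕ → Bool) → ℕ → ℕ → List Bool
segment f k zero    = []
segment f k (suc m) = f k ∷ segment f (suc k) m

-- `lower` lists the cells below the cut downwards and `upper` those from the cut on upwards, so
-- both are read from the cut outwards.
lower : (ℕ → Bool) → ℕ → List Bool
lower = applyDownFrom

lower-cong : ∀ {f g} k → (∀ {v} → v < k → f v ≡ g v) → lower f k ≡ lower g k
lower-cong zero    eq = refl
lower-cong (suc k) eq = cong₂ _∷_ (eq ≤-refl) (lower-cong k (λ v<k → eq (m≤n⇒m≤1+n v<k)))

upper : (ℕ → Bool) → ℕ → ℕ → List Bool
upper f k n = segment f k (n ∸ k)

segment-cong : ∀ {f g} k l m → (∀ {i} → i < m → f (i + k) ≡ g (i + l)) → segment f k m ≡ segment g l m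
segment-cong k l zero    eq = refl
segment-cong {f} {g} k l (suc m) eq = cong₂ _∷_ (eq (s≤s z≤n)) (segment-cong (suc k) (suc l) m λ {i} i<m →
  trans (cong f (+-suc i k)) (trans (eq (s≤s i<m)) (cong g (sym (+-suc i l)))))

segment-∷ʳ : ∀ f k m → segment f k (suc m) ≡ segment f k m ∷ʳ f (m + k)
segment-∷ʳ f k zero    = refl
segment-∷ʳ f k (suc m) = cong (f k ∷_) (trans (segment-∷ʳ f (suc k) m)
  (cong (λ v → segment f (suc k) m ∷ʳ f v) (+-suc m k)))

upper-∷ : ∀ f {k n} → k < n → upper f k n ≡ f k ∷ upper f (suc k) n
upper-∷ f {k} {suc n} (s≤s k≤n) = cong (segment f k) (+-∸-assoc 1 k≤n)

trues : List Bool → ℕ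
trues = sum ∘ map bit

trues-↭ : ∀ {xs ys} → xs ↭ ys → trues xs ≡ trues ys
trues-↭ p = sum-↭ (map⁺ bit p)

trues-split : ∀ f k m → trues (lower f k ++ segment f k m) ≡ trues (lower f (m + k))
trues-split f k zero    = cong trues (++-identityʳ (lower f k))
trues-split f k (suc m) = begin
  trues (lower f k ++ f k ∷ segment f (suc k) m)  ≡⟨ trues-↭ (shift (f k) (lower f k) _) ⟩
  trues (lower f (suc k) ++ segment f (suc k) m)  ≡⟨ trues-split f (suc k) m ⟩
  trues (lower f (m + suc k))                     ≡⟨ cong (trues ∘ lower f) (+-suc m k) ⟩
  trues (lower f (suc m + k))                     ∎
  where open ≡-Reasoning

trues-lower-upper : ∀ f {k n} → k ≤ n → trues (lower f k ++ upper f k n) ≡ trues (lower f n)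
trues-lower-upper f {k} {n} k≤n = trans (trues-split f k (n ∸ k)) (cong (trues ∘ lower f) (m∸n+n≡m k≤n))

trues-lower : ∀ f n → trues (lower f n) ≡ length (filterᵇ f (downFrom n))
trues-lower f zero    = refl
trues-lower f (suc n) with f n
... | true  = cong suc (trues-lower f n)
... | false = trues-lower f n

walk-lower : ∀ Ψ f {k n} → k ≤ n →
  walk Ψ (lower f k) (upper f k n) ≡ sum (applyUpTo (λ p → Ψ (lower f p) (upper f (suc p) n)) k)
walk-lower Ψ f {zero}  {n} _   = refl
walk-lower Ψ f {suc k} {n} k<n = begin
  Ψ (lower f k) (upper f (suc k) n) + walk Ψ (lower f k) (f k ∷ upper f (suc k) n)
    ≡⟨ cong (λ A → Ψ (lower f k) (upper f (suc k) n) + walk Ψ (lower f k) A) (upper-∷ f k<n) ⟨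
  Ψ (lower f k) (upper f (suc k) n) + walk Ψ (lower f k) (upper f k n)
    ≡⟨ cong (Ψ (lower f k) (upper f (suc k) n) +_) (walk-lower Ψ f (<⇒≤ k<n)) ⟩
  G k + sum (applyUpTo G k)
    ≡⟨ sum-applyUpTo-∷ʳ G k ⟨
  sum (applyUpTo G (suc k)) ∎
  where
  open ≡-Reasoning
  G = λ p → Ψ (lower f p) (upper f (suc p) n)

walk-segment : ∀ Ψ f k m →
  walk Ψ (segment f k m) (lower f k) ≡ sum (applyUpTo (λ i → Ψ (segment f (suc (i + k)) (m ∸ suc i)) (lower f (i + k))) m)
walk-segment Ψ f k zero    = refl
walk-segment Ψ f k (suc m) = cong (Ψ (segment f (suc k) m) (lower f k) +_)
  (trans (walk-segment Ψ f (suc k) m) (sum-applyUpTo-cong m λ {i} _ →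
    cong (λ v → Ψ (segment f (suc v) (m ∸ suc i)) (lower f v)) (+-suc i k)))

walk-upper : ∀ Ψ f {k n} → k ≤ n →
  walk Ψ (upper f k n) (lower f k) ≡
  sum (applyUpTo (λ i → Ψ (upper f (suc (i + k)) n) (lower f (i + k))) (n ∸ k))
walk-upper Ψ f {k} {n} k≤n = trans (walk-segment Ψ f k (n ∸ k)) (sum-applyUpTo-cong (n ∸ k) λ {i} _ →
  cong (λ l → Ψ (segment f (suc (i + k)) l) (lower f (i + k)))
    (trans (∸-+-assoc n k (suc i)) (cong (n ∸_) (+-comm k (suc i)))))

-- Picking cell `p` leaves the cells below `p` and those above it wherever the cut `k` was. The two
-- walks therefore form one sum over all cells, in which `k` only decides between `Ψ₁` and `Ψ₂`.
walks-sum : ∀ Ψ₁ Ψ₂ f {k n} → k ≤ n → (G : ℕ → ℕ) →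
  (∀ {p} → p < k → G p ≡ Ψ₁ (lower f p) (upper f (suc p) n)) →
  (∀ {p} → k ≤ p → p < n → G p ≡ Ψ₂ (upper f (suc p) n) (lower f p)) →
  walk Ψ₁ (lower f k) (upper f k n) + walk Ψ₂ (upper f k n) (lower f k) ≡ sum (applyUpTo G n)
walks-sum Ψ₁ Ψ₂ f {k} {n} k≤n G G≡below G≡above = begin
  walk Ψ₁ (lower f k) (upper f k n) + walk Ψ₂ (upper f k n) (lower f k)
    ≡⟨ cong₂ _+_ (walk-lower Ψ₁ f k≤n) (walk-upper Ψ₂ f k≤n) ⟩
  _ ≡⟨ cong₂ _+_ (sum-applyUpTo-cong k G≡below) (sum-applyUpTo-cong (n ∸ k) λ {i} i<n∸k →
         G≡above (m≤n+m k i) (subst (i + k <_) (m∸n+n≡m k≤n) (+-monoˡ-< k i<n∸k))) ⟨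
  sum (applyUpTo G k) + sum (applyUpTo (λ i → G (i + k)) (n ∸ k))
    ≡⟨ sum-applyUpTo-+ G k (n ∸ k) ⟨
  sum (applyUpTo G ((n ∸ k) + k))
    ≡⟨ cong (sum ∘ applyUpTo G) (m∸n+n≡m k≤n) ⟩
  sum (applyUpTo G n) ∎
  where open ≡-Reasoning

-- Sums over the levels of a generating tree

module _ {A B C : Set} where

  sum-cartesianProductWith : ∀ (g : C → ℕ) (f : A → B → C) xs ys →
    sum (map g (cartesianProductWith f xs ys)) ≡ sum (map (λ x → sum (map (g ∘ f x) ys)) xs)
  sum-cartesianProductWith g f []       ys = refl
  sum-cartesianProductWith g f (x ∷ xs) ys = begin
    sum (map g (map (f x) ys ++ cartesianProductWith f xs ys))
      ≡⟨ cong sum (map-++ g (map (f x) ys) _) ⟩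
    sum (map g (map (f x) ys) ++ map g (cartesianProductWith f xs ys))
      ≡⟨ sum-++ (map g (map (f x) ys)) _ ⟩
    sum (map g (map (f x) ys)) + sum (map g (cartesianProductWith f xs ys))
      ≡⟨ cong₂ _+_ (cong sum (sym (map-∘ ys))) (sum-cartesianProductWith g f xs ys) ⟩
    sum (map (g ∘ f x) ys) + sum (map (λ x → sum (map (g ∘ f x) ys)) xs) ∎
    where open ≡-Reasoning

  concatMap-map : ∀ (f : A → B → C) xs ys →
    concatMap (λ x → map (f x) ys) xs ≡ cartesianProductWith f xs ys
  concatMap-map f []       ys = refl
  concatMap-map f (x ∷ xs) ys = cong (map (f x) ys ++_) (concatMap-map f xs ys)

length-filterᵇ : ∀ {A : Set} (t : A → Bool) xs → length (filterᵇ t xs) ≡ sum (map (bit ∘ t) xs)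
length-filterᵇ t []       = refl
length-filterᵇ t (x ∷ xs) with t x
... | true  = cong suc (length-filterᵇ t xs)
... | false = length-filterᵇ t xs

module _ {X : Set} (level : ℕ → List X) (child : X → ℕ → X)
  (level-suc : ∀ n → level (suc n) ↭ cartesianProductWith child (level n) (upTo (suc n)))
  (value : ℕ → X → ℕ)
  (value-suc : ∀ m n {x} → x ∈ level (suc n) →
     value (suc m) x ≡ sum (applyUpTo (λ p → value m (child x p)) (suc (suc n))))
  where

  -- By `value-suc` a value splits over the children, and by `level-suc` the children form the next
  -- level, so each round trades one step of `m` for one level. Levels start at `suc n` so that
  -- every word has a last letter.
  sum-level : ∀ m n → sum (map (value m) (level (suc n))) ≡ sum (map (value 0) (level (suc (m + n))))
  sum-level zero    n = refl
  sum-level (suc m) n = begin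
    sum (map (value (suc m)) (level (suc n)))
      ≡⟨ cong sum (map-cong-local (All.tabulate (λ {x} x∈ →
           trans (value-suc m n x∈) (cong sum (sym (map-upTo (value m ∘ child x) (suc (suc n)))))))) ⟩
    sum (map (λ x → sum (map (value m ∘ child x) (upTo (suc (suc n))))) (level (suc n)))
      ≡⟨ sum-cartesianProductWith (value m) child (level (suc n)) _ ⟨
    sum (map (value m) (cartesianProductWith child (level (suc n)) (upTo (suc (suc n)))))
      ≡⟨ sum-↭ (map⁺ (value m) (level-suc (suc n))) ⟨
    sum (map (value m) (level (suc (suc n))))
      ≡⟨ sum-level m (suc n) ⟩
    sum (map (value 0) (level (suc (m + suc n))))
      ≡⟨ cong (sum ∘ map (value 0) ∘ level ∘ suc) (+-suc m n) ⟩
    sum (map (value 0) (level (suc (suc m + n)))) ∎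
    where open ≡-Reasoning

-- The row always contains one marked cell that counts for nothing: the value 1 in a table,
-- the right end of the inverse of a permutation.
final : ℕ → ℕ → ℕ → Statistic
final a b d B A = bit ((d ≡ᵇ a) ∧ (trues (B ++ A) ≡ᵇ suc b))

final-flat : ∀ a b d → Flat (final a b d)
final-flat a b d p = cong (λ t → bit ((d ≡ᵇ a) ∧ (t ≡ᵇ suc b))) (trues-↭ p)

unique-↭ : ∀ {A : Set} {xs ys : List A} → Unique xs → Unique ys →
           (∀ {x} → x ∈ xs → x ∈ ys) → (∀ {x} → x ∈ ys → x ∈ xs) → xs ↭ ys
unique-↭ u v to from = ∼bag⇒↭ (unique∧set⇒bag u v (mk⇔ to from))

does⁺ : ∀ {A : Set} (a? : Dec A) → A → T (does a?)
does⁺ (yes _) _ = _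
does⁺ (no ¬a) a = ¬a a

does⁻ : ∀ {A : Set} (a? : Dec A) → T (does a?) → A
does⁻ (yes a) _ = a

length-∷ʳ : ∀ {A : Set} (xs : List A) x → length (xs ∷ʳ x) ≡ suc (length xs)
length-∷ʳ xs x = trans (length-++ xs) (+-comm (length xs) 1)

-- Inversion tables

last : List ℕ → ℕ
last []          = 0
last (x ∷ [])    = x
last (x ∷ y ∷ r) = last (y ∷ r)

last-∷ʳ : ∀ xs y → last (xs ∷ʳ y) ≡ y
last-∷ʳ []          y = refl
last-∷ʳ (x ∷ [])    y = refl
last-∷ʳ (x ∷ z ∷ r) y = last-∷ʳ (z ∷ r) y

asc-∷ʳ : ∀ xs y → 0 < length xs → asc (xs ∷ʳ y) ≡ bit (last xs <ᵇ y) + asc xs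
asc-∷ʳ (x ∷ [])    y _ = refl
asc-∷ʳ (x ∷ z ∷ r) y _ = trans (cong (bit (x <ᵇ z) +_) (asc-∷ʳ (z ∷ r) y (s≤s z≤n)))
  (x∙yz≈y∙xz (bit (x <ᵇ z)) (bit (last (z ∷ r) <ᵇ y)) (asc (z ∷ r)))

extend : List ℕ → ℕ → List ℕ
extend e p = e ∷ʳ suc p

invTables-suc : ∀ n → invTables (suc n) ↭ cartesianProductWith extend (invTables n) (upTo (suc n))
invTables-suc n = ↭-reflexive (concatMap-map extend (invTables n) (upTo (suc n)))

data ExtendView (n : ℕ) : List ℕ → Set where
  extended : ∀ {e p} → e ∈ invTables n → p < suc n → ExtendView n (extend e p)

extendView : ∀ n {e} → e ∈ invTables (suc n) → ExtendView n e
extendView n e∈ with ∈-cartesianProductWith⁻ extend (invTables n) (upTo (suc n))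
                       (subst (_ ∈_) (concatMap-map extend (invTables n) (upTo (suc n))) e∈)
... | _ , _ , e₀∈ , p∈ , refl = extended e₀∈ (∈-upTo⁻ p∈)

invTables-length : ∀ n {e} → e ∈ invTables n → length e ≡ n
invTables-length zero    (here refl) = refl
invTables-length (suc n) e∈ with extendView n e∈
... | extended {e} {p} e₀∈ _ = trans (length-∷ʳ e (suc p)) (cong suc (invTables-length n e₀∈))

invTables-letter : ∀ n {e x} → e ∈ invTables n → x ∈ e → ∃ λ y → x ≡ suc y × y < n
invTables-letter zero    (here refl) ()
invTables-letter (suc n) e∈ x∈ with extendView n e∈
... | extended {e} {p} e₀∈ p<n with ∈-++⁻ e x∈
...   | inj₂ (here refl) = p , refl , p<n
...   | inj₁ x∈e = let y , eq , y<n = invTables-letter n e₀∈ x∈e in y , eq , m<n⇒m<1+n y<n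

1∈invTable : ∀ n {e} → e ∈ invTables (suc n) → 1 ∈ e
1∈invTable n e∈ with extendView n e∈
1∈invTable zero    e∈ | extended {p = zero}  (here refl) _        = here refl
1∈invTable zero    e∈ | extended {p = suc _} _           (s≤s ())
1∈invTable (suc n) e∈ | extended e₀∈ _ = ∈-++⁺ˡ (1∈invTable n e₀∈)

invTables-last : ∀ n {e} → e ∈ invTables (suc n) → last e ≤ suc n
invTables-last n e∈ with extendView n e∈
... | extended {e} {p} _ p<1+n rewrite last-∷ʳ e (suc p) = p<1+n

-- Cell `v` stands for the letter `suc v`, since cells are numbered from 0 and letters from 1.
used : List ℕ → ℕ → Bool
used e v = does (suc v ∈? e)

used-extend-≢ : ∀ e {p v} → v ≢ p → used (extend e p) v ≡ used e v
used-extend-≢ e {p} {v} v≢p = does-⇔ (mk⇔ to ∈-++⁺ˡ) (suc v ∈? extend e p) (suc v ∈? e)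
  where
  to : suc v ∈ extend e p → suc v ∈ e
  to v∈ with ∈-++⁻ e v∈
  ... | inj₁ v∈e         = v∈e
  ... | inj₂ (here refl) = contradiction refl v≢p

lower-extend : ∀ e p → lower (used (extend e p)) (suc p) ≡ true ∷ lower (used e) p
lower-extend e p = cong₂ _∷_ (dec-true (suc p ∈? extend e p) (∈-++⁺ʳ e (here refl)))
  (lower-cong p (λ v<p → used-extend-≢ e (<⇒≢ v<p)))

-- The longer table makes the letter `n + 2` newly admissible. It exceeds every letter present,
-- which gives the unmarked cell at the far end.
upper-extend : ∀ n {e p} → e ∈ invTables n → p < suc n →
  upper (used (extend e p)) (suc p) (suc (suc n)) ≡ upper (used e) (suc p) (suc n) ∷ʳ false
upper-extend n {e} {p} e∈ (s≤s p≤n) = begin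
  segment f′ (suc p) (suc n ∸ p)
    ≡⟨ cong (segment f′ (suc p)) (+-∸-assoc 1 p≤n) ⟩
  segment f′ (suc p) (suc (n ∸ p))
    ≡⟨ segment-∷ʳ f′ (suc p) (n ∸ p) ⟩
  segment f′ (suc p) (n ∸ p) ∷ʳ f′ ((n ∸ p) + suc p)
    ≡⟨ cong₂ _∷ʳ_ (segment-cong (suc p) (suc p) (n ∸ p) λ {i} _ → used-extend-≢ e (>⇒≢ (m≤n+m (suc p) i)))
                  (trans (cong f′ n-p+1+p) f′-top) ⟩
  segment (used e) (suc p) (n ∸ p) ∷ʳ false ∎
  where
  open ≡-Reasoning
  f′ = used (extend e p)
  n-p+1+p : (n ∸ p) + suc p ≡ suc n
  n-p+1+p = trans (+-suc (n ∸ p) p) (cong suc (m∸n+n≡m p≤n))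
  f′-top : f′ (suc n) ≡ false
  f′-top = trans (used-extend-≢ e (>⇒≢ (s≤s p≤n))) (dec-false (suc (suc n) ∈? e) λ n+2∈e →
    let y , eq , y<n = invTables-letter n e∈ n+2∈e in
    <-asym (subst (_< n) (sym (suc-injective eq)) y<n) (n<1+n n))

-- Both counts are lengths of duplicate-free lists of the letters of `e`; the `suc` on the left
-- restores the letter 1, which occurs in every nonempty table.
row-used : ∀ n {e} → e ∈ invTables (suc n) → suc (row e) ≡ length (filterᵇ (used e) (downFrom (suc n)))
row-used n {e} e∈ = trans (↭-length (unique-↭ unique₁ unique₂ to from)) (length-map suc letters)
  where
  not-one = λ x → not (x ≡ᵇ 1)
  others  = deduplicate _≟_ (filterᵇ not-one e)
  letters = filterᵇ (used e) (downFrom (suc n))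
  others⁻ : ∀ {x} → x ∈ others → x ∈ e × T (not-one x)
  others⁻ x∈ = ∈-filter⁻ (T? ∘ not-one) (∈-deduplicate⁻ _≟_ (filterᵇ not-one e) x∈)
  unique₁ : Unique (1 ∷ others)
  unique₁ = All.tabulate (λ x∈ → λ { refl → proj₂ (others⁻ x∈) }) ∷ deduplicate-! (filterᵇ not-one e)
  unique₂ : Unique (map suc letters)
  unique₂ = Unique.map⁺ suc-injective (Unique.filter⁺ (T? ∘ used e) (Unique.downFrom⁺ (suc n)))
  letter : ∀ {x} → x ∈ e → x ∈ map suc letters
  letter x∈e with invTables-letter (suc n) e∈ x∈e
  ... | y , refl , y<n = ∈-map⁺ suc (∈-filter⁺ (T? ∘ used e) (∈-downFrom⁺ y<n) (does⁺ (suc y ∈? e) x∈e))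
  to : ∀ {x} → x ∈ 1 ∷ others → x ∈ map suc letters
  to (here refl) = letter (1∈invTable n e∈)
  to (there x∈)  = letter (proj₁ (others⁻ x∈))
  from : ∀ {x} → x ∈ map suc letters → x ∈ 1 ∷ others
  from x∈ with ∈-map⁻ suc x∈
  ... | y , y∈ , refl with ∈-filter⁻ (T? ∘ used e) {xs = downFrom (suc n)} y∈
  from x∈ | zero  , _ , refl | _      = here refl
  from x∈ | suc y , _ , refl | _ , Ty = there (∈-deduplicate⁺ _≟_
    (∈-filter⁺ (T? ∘ not-one) (does⁻ (suc (suc y) ∈? e) Ty) _))

module _ (a b : ℕ) where

  -- `B` holds the letters up to `last e`, headed by `last e` itself, and `A` the larger ones, up to
  -- the greatest value `length e + 1` allowed for the next letter.
  tableValue : ℕ → List ℕ → ℕ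
  tableValue m e = continuations pushBack (final a b) m (asc e)
    (lower (used e) (last e)) (upper (used e) (last e) (suc (length e)))

  tableValue-zero : ∀ n {e} → e ∈ invTables (suc n) →
    tableValue 0 e ≡ bit ((asc e ≡ᵇ a) ∧ (row e ≡ᵇ b))
  tableValue-zero n {e} e∈ = cong (λ t → bit ((asc e ≡ᵇ a) ∧ (t ≡ᵇ suc b))) (begin
    trues (lower (used e) (last e) ++ upper (used e) (last e) (suc (length e)))
      ≡⟨ cong (λ l → trues (lower (used e) (last e) ++ upper (used e) (last e) (suc l))) (invTables-length (suc n) e∈) ⟩
    trues (lower (used e) (last e) ++ upper (used e) (last e) (suc (suc n)))
      ≡⟨ trues-lower-upper (used e) (m≤n⇒m≤1+n (invTables-last n e∈)) ⟩
    bit (used e (suc n)) + trues (lower (used e) (suc n))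
      -- The top cell stands for the letter `n + 2`, which is admissible next but cannot have
      -- occurred.
      ≡⟨ cong (λ u → bit u + trues (lower (used e) (suc n))) top-unused ⟩
    trues (lower (used e) (suc n))
      ≡⟨ trues-lower (used e) (suc n) ⟩
    length (filterᵇ (used e) (downFrom (suc n)))
      ≡⟨ row-used n e∈ ⟨
    suc (row e) ∎)
    where
    open ≡-Reasoning
    top-unused : used e (suc n) ≡ false
    top-unused = dec-false (suc (suc n) ∈? e) λ n+2∈e →
      let y , eq , y<1+n = invTables-letter (suc n) e∈ n+2∈e in
      <-irrefl (sym (suc-injective eq)) y<1+n

  tableValue-suc : ∀ m n {e} → e ∈ invTables (suc n) →
    tableValue (suc m) e ≡ sum (applyUpTo (λ p → tableValue m (extend e p)) (suc (suc n)))
  tableValue-suc m n {e} e∈ rewrite invTables-length (suc n) e∈ =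
    walks-sum _ _ (used e) (m≤n⇒m≤1+n (invTables-last n e∈)) (λ p → tableValue m (extend e p))
      -- For `p < last e` the next letter `suc p` is at most `last e`, hence no ascent; from
      -- `p = last e` on it is larger.
      (λ {p} p<l → child p (<-≤-trans p<l (m≤n⇒m≤1+n (invTables-last n e∈)))
        (asc-child p (dec-false (last e <? suc p) (<⇒≱ (s≤s p<l)))))
      (λ {p} l≤p p<N → child p p<N (asc-child p (dec-true (last e <? suc p) (s≤s l≤p))))
    where
    asc-child : ∀ p {c} → (last e <ᵇ suc p) ≡ c → asc (extend e p) ≡ bit c + asc e
    asc-child p refl = asc-∷ʳ e (suc p) (subst (0 <_) (sym (invTables-length (suc n) e∈)) (s≤s z≤n))
    child : ∀ p {d} → p < suc (suc n) → asc (extend e p) ≡ d →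
      tableValue m (extend e p) ≡
      mark pushBack (continuations pushBack (final a b) m d) (lower (used e) p) (upper (used e) (suc p) (suc (suc n)))
    child p p<N refl rewrite last-∷ʳ e (suc p) | length-∷ʳ e (suc p) | invTables-length (suc n) e∈ =
      cong₂ (continuations pushBack (final a b) m (asc (extend e p))) (lower-extend e p) (upper-extend (suc n) e∈ p<N)

  coeffI-value : ∀ n → coeffI (suc n) a b ≡ tableValue n (1 ∷ [])
  coeffI-value n = begin
    coeffI (suc n) a b
      ≡⟨ length-filterᵇ _ (invTables (suc n)) ⟩
    sum (map (λ e → bit ((asc e ≡ᵇ a) ∧ (row e ≡ᵇ b))) (invTables (suc n)))
      ≡⟨ cong sum (map-cong-local (All.tabulate (tableValue-zero n))) ⟨
    sum (map (tableValue 0) (invTables (suc n)))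
      ≡⟨ cong (sum ∘ map (tableValue 0) ∘ invTables ∘ suc) (+-identityʳ n) ⟨
    sum (map (tableValue 0) (invTables (suc (n + 0))))
      ≡⟨ sum-level invTables extend invTables-suc tableValue tableValue-suc n 0 ⟨
    tableValue n (1 ∷ []) + 0
      ≡⟨ +-identityʳ _ ⟩
    tableValue n (1 ∷ []) ∎
    where
    open ≡-Reasoning

-- Permutations

record IsPerm (n : ℕ) (w : List ℕ) : Set where
  constructor isPerm
  field
    length≡ : length w ≡ n
    bounded : All (_< n) w
    unique  : Unique w

words-∷ : ∀ k m → words (suc k) m ≡ cartesianProductWith _∷_ (upTo m) (words k m)
words-∷ k m = concatMap-map _∷_ (upTo m) (words k m)

words-unique : ∀ k m → Unique (words k m)
words-unique zero    m = [] ∷ []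
words-unique (suc k) m = subst Unique (sym (words-∷ k m))
  (Unique.cartesianProductWith⁺ _∷_ (λ { refl → refl , refl }) (Unique.upTo⁺ m) (words-unique k m))

∈-words⁺ : ∀ {m} w → All (_< m) w → w ∈ words (length w) m
∈-words⁺     []      []           = here refl
∈-words⁺ {m} (x ∷ w) (x<m ∷ w<m) = subst (_ ∈_) (sym (words-∷ (length w) m))
  (∈-cartesianProductWith⁺ _∷_ (∈-upTo⁺ x<m) (∈-words⁺ w w<m))

∈-words⁻ : ∀ k m {w} → w ∈ words k m → length w ≡ k × All (_< m) w
∈-words⁻ zero    m (here refl) = refl , []
∈-words⁻ (suc k) m w∈
  with ∈-cartesianProductWith⁻ _∷_ (upTo m) (words k m) (subst (_ ∈_) (words-∷ k m) w∈)
... | x , w , x∈ , w∈ , refl = let l , b = ∈-words⁻ k m w∈ in cong suc l , ∈-upTo⁻ x∈ ∷ b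

isUnique : List ℕ → Bool
isUnique w = does (unique? w)

perms-unique : ∀ n → Unique (perms n)
perms-unique n = Unique.filter⁺ (T? ∘ isUnique) (words-unique n n)

∈-perms⁺ : ∀ {n w} → IsPerm n w → w ∈ perms n
∈-perms⁺ {w = w} (isPerm refl b u) = ∈-filter⁺ (T? ∘ isUnique) (∈-words⁺ w b) (does⁺ (unique? w) u)

∈-perms⁻ : ∀ n {w} → w ∈ perms n → IsPerm n w
∈-perms⁻ n {w} w∈ =
  let w∈words , u = ∈-filter⁻ (T? ∘ isUnique) {xs = words n n} w∈
      l , b       = ∈-words⁻ n n w∈words
  in isPerm l b (does⁻ (unique? w) u)

-- Extending a permutation word by a last letter

punch : ℕ → ℕ → ℕ
punch p x = if x <ᵇ p then x else suc x

unpunch : ℕ → ℕ → ℕ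
unpunch p x = if x <ᵇ p then x else pred x

punch-< : ∀ {p x} → x < p → punch p x ≡ x
punch-< {p} {x} x<p = cong (if_then x else suc x) (dec-true (x <? p) x<p)

punch-≥ : ∀ {p x} → p ≤ x → punch p x ≡ suc x
punch-≥ {p} {x} p≤x = cong (if_then x else suc x) (dec-false (x <? p) (≤⇒≯ p≤x))

punch-mono-< : ∀ p {x y} → x < y → punch p x < punch p y
punch-mono-< p {x} {y} x<y with x <? p | y <? p
... | yes x<p | yes y<p rewrite punch-< x<p | punch-< y<p = x<y
... | yes x<p | no  y≮p rewrite punch-< x<p | punch-≥ (≮⇒≥ y≮p) = m<n⇒m<1+n x<y
... | no  x≮p | yes y<p = contradiction (<-trans x<y y<p) x≮p
... | no  x≮p | no  y≮p rewrite punch-≥ (≮⇒≥ x≮p) | punch-≥ (≮⇒≥ y≮p) = s≤s x<y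

punch-cancel-< : ∀ p {x y} → punch p x < punch p y → x < y
punch-cancel-< p {x} {y} q with x <? y
... | yes x<y = x<y
... | no  x≮y with m≤n⇒m<n∨m≡n (≮⇒≥ x≮y)
...   | inj₁ y<x  = contradiction q (<-asym (punch-mono-< p y<x))
...   | inj₂ refl = contradiction q (<-irrefl refl)

punch-injective : ∀ p → Injective _≡_ _≡_ (punch p)
punch-injective p {x} {y} eq = ≤-antisym
  (≮⇒≥ λ y<x → <-irrefl (sym eq) (punch-mono-< p y<x))
  (≮⇒≥ λ x<y → <-irrefl eq (punch-mono-< p x<y))

punch-≢ : ∀ p x → punch p x ≢ p
punch-≢ p x with x <? p
... | yes x<p rewrite punch-< x<p = <⇒≢ x<p
... | no  x≮p rewrite punch-≥ (≮⇒≥ x≮p) = >⇒≢ (s≤s (≮⇒≥ x≮p))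

punch-bounded : ∀ p {x n} → x < n → punch p x < suc n
punch-bounded p {x} x<n with x <? p
... | yes x<p rewrite punch-< x<p = m<n⇒m<1+n x<n
... | no  x≮p rewrite punch-≥ (≮⇒≥ x≮p) = s≤s x<n

punch-unpunch : ∀ {p x} → x ≢ p → punch p (unpunch p x) ≡ x
punch-unpunch {p} {x} x≢p with <-cmp x p
... | tri< x<p _ _ rewrite dec-true (x <? p) x<p = punch-< x<p
... | tri≈ _ x≡p _ = contradiction x≡p x≢p
punch-unpunch {p} {suc x} x≢p | tri> _ _ p<x
  rewrite dec-false (suc x <? p) (<⇒≯ p<x) = punch-≥ (s≤s⁻¹ p<x)

unpunch-bounded : ∀ {p x n} → x ≢ p → p < suc n → x < suc n → unpunch p x < n
unpunch-bounded {p} {x} x≢p p<1+n x<1+n with <-cmp x p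
... | tri< x<p _ _ rewrite dec-true (x <? p) x<p = <-≤-trans x<p (s≤s⁻¹ p<1+n)
... | tri≈ _ x≡p _ = contradiction x≡p x≢p
unpunch-bounded {p} {suc x} x≢p p<1+n x<1+n | tri> _ _ p<x
  rewrite dec-false (suc x <? p) (<⇒≯ p<x) = s≤s⁻¹ x<1+n

append : List ℕ → ℕ → List ℕ
append w p = map (punch p) w ∷ʳ p

append-injective : ∀ {w w′ p p′} → append w p ≡ append w′ p′ → w ≡ w′ × p ≡ p′
append-injective {w} {w′} {p} eq with ∷ʳ-injective (map (punch p) w) _ eq
... | eq′ , refl = map-injective (punch-injective p) eq′ , refl

length-append : ∀ w p → length (append w p) ≡ suc (length w)
length-append w p = trans (length-∷ʳ (map (punch p) w) p) (cong suc (length-map (punch p) w))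

∉-map-punch : ∀ p w → p ∉ map (punch p) w
∉-map-punch p w p∈ = let x , _ , eq = ∈-map⁻ (punch p) p∈ in punch-≢ p x (sym eq)

append-isPerm : ∀ {n w p} → IsPerm n w → p < suc n → IsPerm (suc n) (append w p)
append-isPerm {w = w} {p} (isPerm l b u) p<1+n = isPerm
  (trans (length-append w p) (cong suc l))
  (All.∷ʳ⁺ (All.map⁺ (All.map (punch-bounded p) b)) p<1+n)
  (Unique-resp-↭ (↭⇒↭ₛ (∷↭∷ʳ p (map (punch p) w)))
    (All.tabulate (λ x∈ → λ { refl → ∉-map-punch p w x∈ }) ∷ Unique.map⁺ (punch-injective p) u))

data AppendView (n : ℕ) : List ℕ → Set where
  appended : ∀ {w p} → w ∈ perms n → p < suc n → AppendView n (append w p)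

-- Remove the last letter `p` and close the hole it leaves. By uniqueness the other letters differ
-- from `p`, so `punch p` undoes `unpunch p` on them.
appendView : ∀ n {w} → w ∈ perms (suc n) → AppendView n w
appendView n {w} w∈ with initLast w | ∈-perms⁻ (suc n) w∈
... | []      | isPerm () _ _
... | w ∷ʳ′ p | isPerm l b u
  with All.∷ʳ⁻ b | Unique-resp-↭ (↭⇒↭ₛ (↭-sym (∷↭∷ʳ p w))) u
...   | w<1+n , p<1+n | p∉w ∷ w! =
  subst (AppendView n ∘ (_∷ʳ p)) restore (appended (∈-perms⁺ (isPerm
    (trans (length-map (unpunch p) w) (suc-injective (trans (sym (length-∷ʳ w p)) l)))
    (All.map⁺ (All.tabulate λ x∈ → unpunch-bounded (≢-sym (All.lookup p∉w x∈)) p<1+n (All.lookup w<1+n x∈)))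
    (Unique.map⁻ (subst Unique (sym restore) w!)))) p<1+n)
  where
  restore : map (punch p) (map (unpunch p) w) ≡ w
  restore = trans (sym (map-∘ w)) (map-id-local (All.map (punch-unpunch ∘ ≢-sym) p∉w))

-- `perms` lists words lexicographically and the children come in another order, hence only a
-- rearrangement: both lists are duplicate-free with the same elements.
perms-suc : ∀ n → perms (suc n) ↭ cartesianProductWith append (perms n) (upTo (suc n))
perms-suc n = unique-↭ (perms-unique (suc n))
  (Unique.cartesianProductWith⁺ append append-injective (perms-unique n) (Unique.upTo⁺ (suc n)))
  to from
  where
  to : ∀ {w} → w ∈ perms (suc n) → w ∈ cartesianProductWith append (perms n) (upTo (suc n))
  to w∈ with appendView n w∈
  ... | appended w₀∈ p<1+n = ∈-cartesianProductWith⁺ append w₀∈ (∈-upTo⁺ p<1+n)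
  from : ∀ {w} → w ∈ cartesianProductWith append (perms n) (upTo (suc n)) → w ∈ perms (suc n)
  from w∈ with ∈-cartesianProductWith⁻ append (perms n) (upTo (suc n)) w∈
  ... | w₀ , p , w₀∈ , p∈ , refl = ∈-perms⁺ (append-isPerm (∈-perms⁻ n w₀∈) (∈-upTo⁻ p∈))

perms-length : ∀ n {w} → w ∈ perms n → length w ≡ n
perms-length n w∈ = IsPerm.length≡ (∈-perms⁻ n w∈)

-- Induction along last letters takes the place of the pigeonhole principle: either `v` is the last
-- letter, or `unpunch p v` occurs in the shorter word.
perms-complete : ∀ n {w v} → w ∈ perms n → v < n → v ∈ w
perms-complete (suc n) {v = v} w∈ v<1+n with appendView n w∈
... | appended {w} {p} w₀∈ p<1+n with v ≟ p
...   | yes refl = ∈-++⁺ʳ (map (punch p) w) (here refl)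
...   | no  v≢p  = ∈-++⁺ˡ (subst (_∈ map (punch p) w) (punch-unpunch v≢p)
                     (∈-map⁺ (punch p) (perms-complete n w₀∈ (unpunch-bounded v≢p p<1+n v<1+n))))

perms-last : ∀ n {w} → w ∈ perms (suc n) → last w < suc n
perms-last n w∈ with appendView n w∈
... | appended {w} {p} _ p<1+n rewrite last-∷ʳ (map (punch p) w) p = p<1+n

-- Positions of letters and gaps of the inverse

pos-map : ∀ {g} → Injective _≡_ _≡_ g → ∀ {v} w {ys} → v ∈ w → pos (g v) (map g w ++ ys) ≡ pos v w
pos-map {g} inj {v} (x ∷ w) v∈ with v ≟ x | v∈
... | yes refl | _ rewrite dec-true (v ≟ v) refl | dec-true (g v ≟ g v) refl = refl
... | no v≢x | here v≡x = contradiction v≡x v≢x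
... | no v≢x | there v∈w rewrite dec-false (v ≟ x) v≢x | dec-false (g v ≟ g x) (v≢x ∘ inj) =
  cong suc (pos-map inj w v∈w)

pos-∷ʳ : ∀ {v} w → v ∉ w → pos v (w ∷ʳ v) ≡ length w
pos-∷ʳ {v} []      v∉ rewrite dec-true (v ≟ v) refl = refl
pos-∷ʳ {v} (x ∷ w) v∉ rewrite dec-false (v ≟ x) (v∉ ∘ here) = cong suc (pos-∷ʳ w (v∉ ∘ there))

pos-< : ∀ {v} w → v ∈ w → pos v w < length w
pos-< {v} (x ∷ w) v∈ with v ≟ x | v∈
... | yes v≡x | _ rewrite dec-true (v ≟ x) v≡x = s≤s z≤n
... | no  v≢x | here v≡x  = contradiction v≡x v≢x
... | no  v≢x | there v∈w rewrite dec-false (v ≟ x) v≢x = s≤s (pos-< w v∈w)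

-- As `pos v w` is entry `v` of the inverse, this is a descent of the inverse from entry `v - 1` to
-- entry `v`.
inverted : List ℕ → ℕ → Bool
inverted w v = pos v w <ᵇ pos (pred v) w

-- Gap v of the inverse of w precedes its entry number v.  Gap 0 is unmarked because
-- pred 0 = 0, and the right end, gap length w, is marked by convention.
gap : List ℕ → ℕ → Bool
gap w v = (v ≡ᵇ length w) ∨ inverted w v

gap-top : ∀ {w v} → v ≡ length w → gap w v ≡ true
gap-top {w} {v} eq = cong (_∨ inverted w v) (dec-true (v ≟ length w) eq)

gap-below : ∀ {w v} → v ≢ length w → gap w v ≡ inverted w v
gap-below {w} {v} neq = cong (_∨ inverted w v) (dec-false (v ≟ length w) neq)

module _ {n : ℕ} {w : List ℕ} (w∈ : w ∈ perms n) {p : ℕ} (p≤n : p ≤ n) where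
  private
    w′ = append w p
    l  = perms-length n w∈
    l′ : length w′ ≡ suc n
    l′ = trans (length-append w p) (cong suc l)

  pos-append : ∀ {v} → v < n → pos (punch p v) w′ ≡ pos v w
  pos-append v<n = pos-map (punch-injective p) w (perms-complete n w∈ v<n)

  pos-append-< : ∀ {v} → v < p → pos v w′ ≡ pos v w
  pos-append-< v<p = trans (cong (λ u → pos u w′) (sym (punch-< v<p))) (pos-append (<-≤-trans v<p p≤n))

  pos-append-≥ : ∀ {v} → p ≤ v → v < n → pos (suc v) w′ ≡ pos v w
  pos-append-≥ p≤v v<n = trans (cong (λ u → pos u w′) (sym (punch-≥ p≤v))) (pos-append v<n)

  pos-append-≡ : pos p w′ ≡ n
  pos-append-≡ = trans (pos-∷ʳ (map (punch p) w) (∉-map-punch p w)) (trans (length-map (punch p) w) l)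

  pos-bounded : ∀ {v} → v < n → pos v w < n
  pos-bounded v<n = subst (_ <_) l (pos-< w (perms-complete n w∈ v<n))

  gap-append-< : ∀ {v} → v < p → gap w′ v ≡ gap w v
  gap-append-< {v} v<p = begin
    gap w′ v       ≡⟨ gap-below {w′} (<⇒≢ (subst (v <_) (sym l′) (<-≤-trans v<p (m≤n⇒m≤1+n p≤n)))) ⟩
    inverted w′ v  ≡⟨ cong₂ _<ᵇ_ (pos-append-< v<p) (pos-append-< (≤-<-trans pred[n]≤n v<p)) ⟩
    inverted w v   ≡⟨ gap-below {w} (<⇒≢ (subst (v <_) (sym l) (<-≤-trans v<p p≤n))) ⟨
    gap w v        ∎
    where open ≡-Reasoning

  -- Entry `p` of the new inverse is its maximum `n`, and no descent leads up to a maximum.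
  gap-append-≡ : gap w′ p ≡ false
  gap-append-≡ = trans (gap-below {w′} (<⇒≢ (subst (p <_) (sym l′) (s≤s p≤n))))
    (dec-false (pos p w′ <? pos (pred p) w′) (≤⇒≯ (≤-trans (pos-pred p≤n refl) (≤-reflexive (sym pos-append-≡)))))
    where
    pos-pred : ∀ {q} → q ≤ n → q ≡ p → pos (pred q) w′ ≤ n
    -- At the left end `pred 0 = 0`, so the new entry is compared with itself.
    pos-pred {zero}  _   refl = ≤-reflexive pos-append-≡
    pos-pred {suc q} q<n refl = subst (_≤ n) (sym (pos-append-< (n<1+n q))) (<⇒≤ (pos-bounded q<n))

  -- This gap follows the new maximum: it is a descent, or for `p = n` the right end.
  gap-append-suc : gap w′ (suc p) ≡ true
  gap-append-suc with p ≟ n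
  ... | yes p≡n = gap-top {w′} (trans (cong suc p≡n) (sym l′))
  ... | no  p≢n = trans (gap-below {w′} (λ eq → p≢n (suc-injective (trans eq l′))))
    (dec-true (pos (suc p) w′ <? pos p w′)
      (subst (pos (suc p) w′ <_) (sym pos-append-≡)
        (subst (_< n) (sym (pos-append-≥ ≤-refl p<n)) (pos-bounded p<n))))
    where p<n = ≤∧≢⇒< p≤n p≢n

  gap-append-> : ∀ {v} → p < v → v ≤ n → gap w′ (suc v) ≡ gap w v
  gap-append-> {suc v} (s≤s p≤v) v<n with suc v ≟ n
  ... | yes eq  = trans (gap-top {w′} (trans (cong suc eq) (sym l′))) (sym (gap-top {w} (trans eq (sym l))))
  ... | no  neq = begin
    gap w′ (2 + v)       ≡⟨ gap-below {w′} (λ eq → neq (suc-injective (trans eq l′))) ⟩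
    inverted w′ (2 + v)  ≡⟨ cong₂ _<ᵇ_ (pos-append-≥ (m≤n⇒m≤1+n p≤v) (≤∧≢⇒< v<n neq)) (pos-append-≥ p≤v v<n) ⟩
    inverted w (suc v)   ≡⟨ gap-below {w} (λ eq → neq (trans eq l)) ⟨
    gap w (suc v)        ∎
    where open ≡-Reasoning

  -- The new maximum splits the picked gap into an unmarked one on its left and a marked one on its
  -- right, matching `mark pushFront` with the upper gaps as `B`.
  lower-append : lower (gap w′) (suc p) ≡ false ∷ lower (gap w) p
  lower-append = cong₂ _∷_ gap-append-≡ (lower-cong p gap-append-<)

  upper-append : upper (gap w′) (suc p) (suc (suc n)) ≡ true ∷ upper (gap w) (suc p) (suc n)
  upper-append = trans (upper-∷ (gap w′) (s≤s (s≤s p≤n)))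
    (cong₂ _∷_ gap-append-suc (segment-cong (suc (suc p)) (suc p) (n ∸ p) λ {i} i<n∸p →
      trans (cong (gap w′) (+-suc i (suc p)))
        (gap-append-> (m≤n+m (suc p) i)
          (subst (i + suc p ≤_) (m∸n+n≡m p≤n)
            (subst (_≤ (n ∸ p) + p) (sym (+-suc i p)) (+-monoˡ-≤ p i<n∸p))))))

des-∷ʳ : ∀ xs y → 0 < length xs → des (xs ∷ʳ y) ≡ bit (y <ᵇ last xs) + des xs
des-∷ʳ (x ∷ [])    y _ = refl
des-∷ʳ (x ∷ z ∷ r) y _ = trans (cong (bit (z <ᵇ x) +_) (des-∷ʳ (z ∷ r) y (s≤s z≤n)))
  (x∙yz≈y∙xz (bit (z <ᵇ x)) (bit (y <ᵇ last (z ∷ r))) (des (z ∷ r)))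

des-map : ∀ {g} → (∀ x y → (g x <ᵇ g y) ≡ (x <ᵇ y)) → ∀ w → des (map g w) ≡ des w
des-map mono []          = refl
des-map mono (x ∷ [])    = refl
des-map mono (x ∷ y ∷ r) = cong₂ _+_ (cong bit (mono y x)) (des-map mono (y ∷ r))

last-map : ∀ g w → 0 < length w → last (map g w) ≡ g (last w)
last-map g (x ∷ [])    _ = refl
last-map g (x ∷ y ∷ r) _ = last-map g (y ∷ r) (s≤s z≤n)

-- `punch p` keeps the order of the old letters and raises the last one exactly if it is at least
-- `p`; so equality of `p` with `last w` also yields a descent.
des-append : ∀ w p → 0 < length w → des (append w p) ≡ bit (p <ᵇ suc (last w)) + des w
des-append w p w≢[] = begin
  des (append w p)
    ≡⟨ des-∷ʳ (map (punch p) w) p (subst (0 <_) (sym (length-map (punch p) w)) w≢[]) ⟩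
  bit (p <ᵇ last (map (punch p) w)) + des (map (punch p) w)
    ≡⟨ cong₂ _+_ (cong bit (trans (cong (p <ᵇ_) (last-map (punch p) w w≢[])) (below-punch (last w))))
                 (des-map (λ x y → does-⇔ (mk⇔ (punch-cancel-< p) (punch-mono-< p)) (punch p x <? punch p y) (x <? y)) w) ⟩
  bit (p <ᵇ suc (last w)) + des w ∎
  where
  open ≡-Reasoning
  below-punch : ∀ x → (p <ᵇ punch p x) ≡ (p <ᵇ suc x)
  below-punch x with x <? p
  ... | yes x<p rewrite punch-< x<p =
    trans (dec-false (p <? x) (<-asym x<p)) (sym (dec-false (p <? suc x) (≤⇒≯ x<p)))
  ... | no  x≮p rewrite punch-≥ (≮⇒≥ x≮p) = refl

last-applyUpTo : ∀ g n → last (applyUpTo g (suc n)) ≡ g n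
last-applyUpTo g n = trans (cong last (sym (applyUpTo-∷ʳ g n))) (last-∷ʳ (applyUpTo g n) (g n))

-- Cell `v` records a descent from entry `v - 1` to entry `v`; cell 0 compares `g 0` with itself and
-- adds nothing.
des-applyUpTo : ∀ g n → des (applyUpTo g n) ≡ trues (lower (λ v → g v <ᵇ g (pred v)) n)
des-applyUpTo g zero          = refl
des-applyUpTo g (suc zero)    rewrite dec-false (g 0 <? g 0) (<-irrefl refl) = refl
des-applyUpTo g (suc (suc n)) = begin
  des (applyUpTo g (2 + n))
    ≡⟨ cong des (applyUpTo-∷ʳ g (suc n)) ⟨
  des (applyUpTo g (suc n) ∷ʳ g (suc n))
    ≡⟨ des-∷ʳ (applyUpTo g (suc n)) (g (suc n)) (s≤s z≤n) ⟩
  bit (g (suc n) <ᵇ last (applyUpTo g (suc n))) + des (applyUpTo g (suc n))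
    ≡⟨ cong₂ _+_ (cong (λ x → bit (g (suc n) <ᵇ x)) (last-applyUpTo g n)) (des-applyUpTo g (suc n)) ⟩
  bit (g (suc n) <ᵇ g n) + trues (lower (λ v → g v <ᵇ g (pred v)) (suc n)) ∎
  where open ≡-Reasoning

module _ (a b : ℕ) where

  -- The gaps are read from right to left, since picking a gap p ≤ last w scores a descent.
  permState : ℕ → ℕ → List ℕ → ℕ → ℕ → ℕ
  permState m d w x n = continuations pushFront (final a b) m d (upper (gap w) (suc x) (suc n)) (lower (gap w) (suc x))

  permValue : ℕ → List ℕ → ℕ
  permValue m w = permState m (des w) w (last w) (length w)

  permValue-zero : ∀ n {w} → w ∈ perms (suc n) →
    permValue 0 w ≡ bit ((des w ≡ᵇ a) ∧ (des (inverse (suc n) w) ≡ᵇ b))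
  permValue-zero n {w} w∈ = cong (λ t → bit ((des w ≡ᵇ a) ∧ (t ≡ᵇ suc b))) (begin
    trues (upper f (suc (last w)) (suc (length w)) ++ lower f (suc (last w)))
      ≡⟨ trues-↭ (++-comm (upper f (suc (last w)) (suc (length w))) _) ⟩
    trues (lower f (suc (last w)) ++ upper f (suc (last w)) (suc (length w)))
      ≡⟨ cong (λ l → trues (lower f (suc (last w)) ++ upper f (suc (last w)) (suc l))) (perms-length (suc n) w∈) ⟩
    trues (lower f (suc (last w)) ++ upper f (suc (last w)) (2 + n))
      ≡⟨ trues-lower-upper f (m≤n⇒m≤1+n (perms-last n w∈)) ⟩
    bit (f (suc n)) + trues (lower f (suc n))
      -- The right end is marked by convention and supplies the `suc`; all other marks are descents
      -- of the inverse.
      ≡⟨ cong₂ _+_ (cong bit (gap-top {w} (sym (perms-length (suc n) w∈))))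
           (cong trues (lower-cong (suc n) λ {v} v<1+n →
             gap-below {w} (<⇒≢ (subst (v <_) (sym (perms-length (suc n) w∈)) v<1+n)))) ⟩
    suc (trues (lower (inverted w) (suc n)))
      ≡⟨ cong suc (des-applyUpTo (λ v → pos v w) (suc n)) ⟨
    suc (des (applyUpTo (λ v → pos v w) (suc n)))
      ≡⟨ cong (suc ∘ des) (map-upTo (λ v → pos v w) (suc n)) ⟨
    suc (des (inverse (suc n) w)) ∎)
    where
    open ≡-Reasoning
    f = gap w

  permValue-suc : ∀ m n {w} → w ∈ perms (suc n) →
    permValue (suc m) w ≡ sum (applyUpTo (λ p → permValue m (append w p)) (suc (suc n)))
  permValue-suc m n {w} w∈ = trans (cong (permState (suc m) (des w) w (last w)) (perms-length (suc n) w∈))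
    -- Here `B` is the upper part, whereas `walks-sum` takes the walk through the lower part first.
    (trans (+-comm (walk _ (upper (gap w) (suc (last w)) (2 + n)) (lower (gap w) (suc (last w)))) _)
      (walks-sum _ _ (gap w) (m≤n⇒m≤1+n (perms-last n w∈)) (λ p → permValue m (append w p))
        (λ {p} p<l → child p (≤-trans (s≤s⁻¹ p<l) (<⇒≤ (perms-last n w∈))) (des-child p (dec-true (p <? suc (last w)) p<l)))
        (λ {p} l≤p p<N → child p (s≤s⁻¹ p<N) (des-child p (dec-false (p <? suc (last w)) (≤⇒≯ l≤p))))))
    where
    des-child : ∀ p {c} → (p <ᵇ suc (last w)) ≡ c → des (append w p) ≡ bit c + des w
    des-child p refl = des-append w p (subst (0 <_) (sym (perms-length (suc n) w∈)) (s≤s z≤n))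
    child : ∀ p {d} → p ≤ suc n → des (append w p) ≡ d →
      permValue m (append w p) ≡
      mark pushFront (continuations pushFront (final a b) m d) (upper (gap w) (suc p) (2 + n)) (lower (gap w) p)
    child p p≤1+n refl = trans
      (cong₂ (permState m (des (append w p)) (append w p)) (last-∷ʳ (map (punch p) w) p)
        (trans (length-append w p) (cong suc (perms-length (suc n) w∈))))
      (cong₂ (continuations pushFront (final a b) m (des (append w p))) (upper-append w∈ p≤1+n) (lower-append w∈ p≤1+n))

  coeffA-value : ∀ n → coeffA (suc n) a b ≡ permValue n (0 ∷ [])
  coeffA-value n = begin
    coeffA (suc n) a b
      ≡⟨ length-filterᵇ _ (perms (suc n)) ⟩
    sum (map (λ w → bit ((des w ≡ᵇ a) ∧ (des (inverse (suc n) w) ≡ᵇ b))) (perms (suc n)))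
      ≡⟨ cong sum (map-cong-local (All.tabulate (permValue-zero n))) ⟨
    sum (map (permValue 0) (perms (suc n)))
      ≡⟨ cong (sum ∘ map (permValue 0) ∘ perms ∘ suc) (+-identityʳ n) ⟨
    sum (map (permValue 0) (perms (suc (n + 0))))
      ≡⟨ sum-level perms append perms-suc permValue permValue-suc n 0 ⟨
    permValue n (0 ∷ []) + 0
      ≡⟨ +-identityʳ _ ⟩
    permValue n (0 ∷ []) ∎
    where open ≡-Reasoning

theorem1 : (n : ℕ) → 1 ≤ n → (a b : ℕ) → coeffA n a b ≡ coeffI n a b
theorem1 (suc n) _ a b = begin
  coeffA (suc n) a b         ≡⟨ coeffA-value a b n ⟩
  -- Both one-letter words give the same state: one marked cell in `B`, one unmarked cell in `A`,
  -- score 0.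
  permValue a b n (0 ∷ [])   ≡⟨ continuations-pushBack (final-flat a b) n 0 _ _ ⟨
  tableValue a b n (1 ∷ [])  ≡⟨ coeffI-value a b n ⟨
  coeffI (suc n) a b         ∎
  where open ≡-Reasoning
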